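{- There exists an infinite and co-infinite set $A\subset\mathbb{N}$ such that the two-point represented space $D_A$ is not computably Hausdorff.
   Context: A represented space $\mathbf{X}=(X,\delta_{\mathbf{X}})$ is a set $X$ with a partial surjection $\delta_{\mathbf{X}}:\subseteq\mathbb{N}^{\mathbb{N}}\to X$; any $p$ with $\delta_{\mathbf X}(p)=x$ is a name of $x$. A map $f:\mathbf{X}\to\mathbf{Y}$ is computable if some computable partial map on $\mathbb{N}^{\mathbb{N}}$ sends every name of every $x\in X$ to a name of $f(x)$. In the product $\mathbf{X}\times\mathbf{Y}$, $p$ names $(x,y)$ iff $n\mapsto p(2n)$ names $x$ and $n\mapsto p(2n+1)$ names $y$. Sierpinski space $\mathbb{S}=\{\top,\bot\}$ is represented so that $0^\omega$ names $\bot$ and every other sequence names $\top$. A subset of $\mathbf{X}$ is computably open if its characteristic function $\mathbf{X}\to\mathbb{S}$ (value $\top$ exactly on the set) is computable, and computably closed if its complement is computably open. $\mathbf{X}$ is computably Hausdorff if the diagonal $\{(x,x)\}\subseteq\mathbf{X}\times\mathbf{X}$ is computably closed. For an infinite and co-infinite $A\subset\mathbb{N}$, $D_A$ is the represented space with underlying set $\{a,b\}$ (two distinct points) where $p$ is a name for $a$ iff $p$ is obtained from the characteristic function of $A$ by replacing finitely many $1$s with $0$s, and $p$ is a name for $b$ iff it is obtained from the characteristic function of $\mathbb{N}\setminus A$ by replacing finitely many $1$s with $0$s. -}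

module Defs where

open import Data.Bool.Base using (if_then_else_)
open import Data.Fin.Base using (Fin)
open import Data.List.Base using (List; [])
open import Data.List.Extrema.Nat using (max; xs≤max)
open import Data.List.Membership.DecPropositional using () renaming (_∈?_ to mem?)
open import Data.List.Membership.Propositional using (_∈_; _∉_)
open import Data.List.Relation.Unary.All using (lookup)
open import Data.Nat.Base using (ℕ; zero; suc; _+_; _*_; _≤_; _<_)
open import Data.Nat.InfinitelyOften using (Inf)
open import Data.Nat.Properties using (+-suc; <⇒≱; _≟_)
open import Data.Product.Base using (_×_; _,_; ∃-syntax; Σ-syntax; uncurry)
open import Data.Vec.Base using (Vec; _∷_) renaming ([] to []ᵥ; lookup to lookupᵥ)
open import Data.Vec.Relation.Binary.Pointwise.Inductive using (Pointwise)
open import Function.Base using (_∘_)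
open import Function.Bundles using (_⇔_)
open import Level using (0ℓ)
open import Relation.Binary.PropositionalEquality
  using (_≡_; _≗_; refl; sym; trans; cong; cong₂; subst)
open import Relation.Nullary using (¬_; yes; no; does; contradiction)
open import Relation.Unary using (Pred; Decidable; ∁)
open import Relation.Unary.Properties using (∁?)

------------------------------------------------------------------------
-- Computability on Baire space

Baire : Set
Baire = ℕ → ℕ

-- μ-recursive functions relative to an oracle in Baire space.

data Code : ℕ → Set where
  zero   : Code 0
  suc    : Code 1
  proj   : ∀ {n} → Fin n → Code n
  oracle : Code 1
  comp   : ∀ {m n} → Code m → Vec (Code n) m → Code n
  rec    : ∀ {n} → Code n → Code (2 + n) → Code (1 + n)
  μ      : ∀ {n} → Code (1 + n) → Code n

-- p ⊢ c [ xs ]↓ y: with oracle p and on input xs, c halts with output y.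
-- The recursion variable of rec and the search variable of μ come first;
-- the step function of rec takes the counter, then the previous value.

infix 4 _⊢_[_]↓_

data _⊢_[_]↓_ (p : Baire) : ∀ {n} → Code n → Vec ℕ n → ℕ → Set where
  ↓zero   : p ⊢ zero [ []ᵥ ]↓ 0
  ↓suc    : ∀ {x} → p ⊢ suc [ x ∷ []ᵥ ]↓ suc x
  ↓proj   : ∀ {n} {i : Fin n} {xs} → p ⊢ proj i [ xs ]↓ lookupᵥ xs i
  ↓oracle : ∀ {x} → p ⊢ oracle [ x ∷ []ᵥ ]↓ p x
  ↓comp   : ∀ {m n} {c : Code m} {ds : Vec (Code n) m} {xs ys z} →
            Pointwise (λ d y → p ⊢ d [ xs ]↓ y) ds ys →
            p ⊢ c [ ys ]↓ z →
            p ⊢ comp c ds [ xs ]↓ z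
  ↓rec₀   : ∀ {n} {c : Code n} {d xs y} →
            p ⊢ c [ xs ]↓ y →
            p ⊢ rec c d [ 0 ∷ xs ]↓ y
  ↓rec₊   : ∀ {n} {c : Code n} {d k xs y z} →
            p ⊢ rec c d [ k ∷ xs ]↓ y →
            p ⊢ d [ k ∷ y ∷ xs ]↓ z →
            p ⊢ rec c d [ suc k ∷ xs ]↓ z
  ↓μ      : ∀ {n} {c : Code (1 + n)} {xs y} →
            (∀ z → z < y → ∃[ k ] p ⊢ c [ z ∷ xs ]↓ suc k) →
            p ⊢ c [ y ∷ xs ]↓ 0 →
            p ⊢ μ c [ xs ]↓ y

-- The computable partial map on Baire space given by a code; p is in its
-- domain iff the code halts on every n with oracle p.

infix 4 _∶_↦_

_∶_↦_ : Code 1 → Baire → Baire → Set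
e ∶ p ↦ q = ∀ n → p ⊢ e [ n ∷ []ᵥ ]↓ q n

------------------------------------------------------------------------
-- Represented spaces

-- The partial surjection is given by its graph Names. The field resp is
-- needed because sequences are not assumed to satisfy extensionality.

record RepresentedSpace : Set₁ where
  field
    Carrier    : Set
    Names      : Baire → Carrier → Set
    resp       : ∀ {p q x} → p ≗ q → Names p x → Names q x
    functional : ∀ {p x y} → Names p x → Names p y → x ≡ y
    surjective : ∀ x → ∃[ p ] Names p x

open RepresentedSpace public

Computable : (X Y : RepresentedSpace) → (Carrier X → Carrier Y) → Set
Computable X Y f =
  Σ[ e ∈ Code 1 ] (∀ x p → Names X p x → ∃[ q ] (e ∶ p ↦ q × Names Y q (f x)))

evens odds : Baire → Baire
evens p n = p (2 * n)
odds  p n = p (1 + 2 * n)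

private
  interleave : Baire → Baire → Baire
  interleave p q zero    = p 0
  interleave p q (suc n) = interleave q (p ∘ suc) n

  double-suc : ∀ n → 2 * suc n ≡ 2 + 2 * n
  double-suc n = cong suc (+-suc n (n + 0))

  evens-interleave : ∀ p q → p ≗ evens (interleave p q)
  evens-interleave p q zero = refl
  evens-interleave p q (suc n) = trans
    (evens-interleave (p ∘ suc) (q ∘ suc) n)
    (cong (interleave p q) (sym (double-suc n)))

  odds-interleave : ∀ p q → q ≗ odds (interleave p q)
  odds-interleave p q = evens-interleave q (p ∘ suc)

infixr 2 _⊗_

_⊗_ : RepresentedSpace → RepresentedSpace → RepresentedSpace
X ⊗ Y = record
  { Carrier    = Carrier X × Carrier Y
  ; Names      = λ p (x , y) → Names X (evens p) x × Names Y (odds p) y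
  ; resp       = λ p≗q (px , py) →
      resp X (λ n → p≗q (2 * n)) px , resp Y (λ n → p≗q (1 + 2 * n)) py
  ; functional = λ (px , py) (px′ , py′) →
      cong₂ _,_ (functional X px px′) (functional Y py py′)
  ; surjective = surj
  }
  where
  surj : ∀ ((x , y) : Carrier X × Carrier Y) →
         ∃[ p ] (Names X (evens p) x × Names Y (odds p) y)
  surj (x , y) with surjective X x | surjective Y y
  ... | p , px | q , qy =
    interleave p q ,
    resp X (evens-interleave p q) px , resp Y (odds-interleave p q) qy

data Sierpiński : Set where
  ⊤ ⊥ : Sierpiński

NamesSierpiński : Baire → Sierpiński → Set
NamesSierpiński p ⊥ = ∀ n → p n ≡ 0
NamesSierpiński p ⊤ = ¬ (∀ n → p n ≡ 0)

𝕊 : RepresentedSpace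
𝕊 = record
  { Carrier    = Sierpiński
  ; Names      = NamesSierpiński
  ; resp       = λ {_} {_} {x} → resp′ x
  ; functional = λ {_} {x} {y} → fun x y
  ; surjective = surj
  }
  where
  resp′ : ∀ {p q} x → p ≗ q → NamesSierpiński p x → NamesSierpiński q x
  resp′ ⊤ p≗q p≢0 q≡0 = p≢0 (λ n → trans (p≗q n) (q≡0 n))
  resp′ ⊥ p≗q p≡0 n   = trans (sym (p≗q n)) (p≡0 n)

  fun : ∀ {p} x y → NamesSierpiński p x → NamesSierpiński p y → x ≡ y
  fun ⊤ ⊤ _   _   = refl
  fun ⊤ ⊥ p≢0 p≡0 = contradiction p≡0 p≢0
  fun ⊥ ⊤ p≡0 p≢0 = contradiction p≡0 p≢0
  fun ⊥ ⊥ _   _   = refl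

  surj : ∀ x → ∃[ p ] NamesSierpiński p x
  surj ⊤ = (λ _ → 1) , λ 1≡0 → contradiction (1≡0 0) (λ ())
  surj ⊥ = (λ _ → 0) , λ _ → refl

ComputablyOpen : (X : RepresentedSpace) → Pred (Carrier X) 0ℓ → Set
ComputablyOpen X U =
  Σ[ f ∈ (Carrier X → Sierpiński) ] ((∀ x → f x ≡ ⊤ ⇔ U x) × Computable X 𝕊 f)

ComputablyClosed : (X : RepresentedSpace) → Pred (Carrier X) 0ℓ → Set
ComputablyClosed X U = ComputablyOpen X (∁ U)

ComputablyHausdorff : RepresentedSpace → Set
ComputablyHausdorff X = ComputablyClosed (X ⊗ X) (uncurry _≡_)

------------------------------------------------------------------------
-- The two-point spaces

χ : {A : Pred ℕ 0ℓ} → Decidable A → Baire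
χ A? n = if does (A? n) then 1 else 0

-- p arises from q by replacing finitely many 1s with 0s; the list holds the
-- positions at which this happens.

ErasesFinitely : Baire → Baire → Set
ErasesFinitely q p =
  Σ[ ns ∈ List ℕ ]
    (∀ n → (n ∈ ns → q n ≡ 1 × p n ≡ 0) × (n ∉ ns → p n ≡ q n))

data Point : Set where
  a b : Point

-- A? makes the characteristic function of A an element of Baire. It is not an
-- effectivity assumption: under excluded middle every A has such a term.

module _ (A : Pred ℕ 0ℓ) (A? : Decidable A) where

  NamesD : Baire → Point → Set
  NamesD p a = ErasesFinitely (χ A?) p
  NamesD p b = ErasesFinitely (χ (∁? A?)) p

  private
    erases-resp : ∀ {r p q} → p ≗ q → ErasesFinitely r p → ErasesFinitely r q
    erases-resp p≗q (ns , h) = ns , λ n →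
      let (e , k) = h n in
      (λ n∈ → let (r≡1 , p≡0) = e n∈ in r≡1 , trans (sym (p≗q n)) p≡0) ,
      (λ n∉ → trans (sym (p≗q n)) (k n∉))

    erases-refl : ∀ r → ErasesFinitely r r
    erases-refl r = [] , λ n → (λ ()) , (λ _ → refl)

    disjoint : Inf A → ∀ {p} → NamesD p a → ¬ NamesD p b
    disjoint inf {p} (ns , h) (ms , k) = inf (suc (max 0 ns) , none)
      where
      kept : ∀ j → A j → j ∉ ns → p j ≡ 1
      kept j Aj j∉ with A? j | h j
      ... | yes _ | _ , keep = keep j∉
      ... | no ¬Aj | _ = contradiction Aj ¬Aj

      zeroed : ∀ j → A j → p j ≡ 0
      zeroed j Aj with mem? _≟_ j ms | A? j | k j
      ... | yes j∈ | _      | erase , _ = let (_ , p≡0) = erase j∈ in p≡0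
      ... | no j∉  | yes _  | _ , keep  = keep j∉
      ... | no _   | no ¬Aj | _         = contradiction Aj ¬Aj

      none : ∀ j → suc (max 0 ns) ≤ j → ¬ A j
      none j big Aj = contradiction
        (trans (sym (kept j Aj (λ j∈ → <⇒≱ big (lookup (xs≤max 0 ns) j∈)))) (zeroed j Aj))
        (λ ())

  D : Inf A → Inf (∁ A) → RepresentedSpace
  D inf coinf = record
    { Carrier    = Point
    ; Names      = NamesD
    ; resp       = λ {_} {_} {x} → resp′ x
    ; functional = λ {_} {x} {y} → fun x y
    ; surjective = surj
    }
    where
    resp′ : ∀ {p q} x → p ≗ q → NamesD p x → NamesD q x
    resp′ a = erases-resp
    resp′ b = erases-resp

    fun : ∀ {p} x y → NamesD p x → NamesD p y → x ≡ y
    fun a a _  _  = refl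
    fun a b pa pb = contradiction pb (disjoint inf pa)
    fun b a pb pa = contradiction pb (disjoint inf pa)
    fun b b _  _  = refl

    surj : ∀ x → ∃[ p ] NamesD p x
    surj a = χ A? , erases-refl _
    surj b = χ (∁? A?) , erases-refl _

{-# OPTIONS --safe #-}
-- The complement of A is the range of a function g that grows so fast that,
-- for every code e of height at most d, the following holds of the stage
-- N = suc (g d).  If e, run on some pair of 0/1-valued sequences vanishing
-- below N, ever gives a nonzero output, then it does so for a pair and an
-- output for which it reads only entries below g (suc d).  Up to there the two
-- sequences are dominated by A, so they can be continued to two names of a,
-- which e then wrongly declares distinct.  Otherwise e gives only zeros on a
-- name of a and a name of b with their entries below N erased, and so wrongly
-- fails to declare a and b distinct.
module Submission where

open import Defs
open import Axiom.ExcludedMiddle using (ExcludedMiddle)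
open import Data.Bool.Base using (if_then_else_)
open import Data.List.Base
  using (List; []; _∷_; _++_; map; concatMap; cartesianProductWith; upTo; allFin; filter)
open import Data.List.Extrema.Nat using (max; xs≤max)
open import Data.List.Membership.DecPropositional using () renaming (_∈?_ to mem?)
open import Data.List.Membership.Propositional using (_∈_; lose)
open import Data.List.Membership.Propositional.Properties
  using (∈-++⁺ˡ; ∈-++⁺ʳ; ∈-map⁺; ∈-concatMap⁺; ∈-cartesianProductWith⁺; ∈-upTo⁺; ∈-allFin;
         ∈-filter⁺; ∈-filter⁻)
open import Data.List.Relation.Unary.All using (lookup)
open import Data.List.Relation.Unary.Any using (here; there)
open import Data.Nat.Base
  using (ℕ; zero; suc; _+_; _*_; _⊔_; _≤_; _<_; s≤s; s≤s⁻¹; _≤′_; ≤′-refl; ≤′-step)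
open import Data.Nat.InfinitelyOften using (Inf)
open import Data.Nat.Properties
open import Data.Product.Base using (_×_; _,_; ∃-syntax; Σ-syntax; proj₁; proj₂)
open import Data.Sum.Base using (_⊎_; inj₁; inj₂)
open import Data.Vec.Base using (Vec; []; _∷_)
open import Data.Vec.Relation.Binary.Pointwise.Inductive using (Pointwise; []; _∷_)
open import Function.Base using (_∘_)
open import Function.Bundles using (Equivalence)
open import Level using (0ℓ)
open import Relation.Binary.Definitions using (tri<; tri≈; tri>)
open import Relation.Binary.PropositionalEquality
open import Relation.Nullary using (¬_; Dec; yes; no; does; ¬?; contradiction)
open import Relation.Nullary.Decidable using (dec-true; dec-false; decidable-stable)
open import Relation.Unary using (Pred; Decidable; ∁)
open import Relation.Unary.Properties using (∁?)

-- Evaluation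

mutual

  ↓-deterministic : ∀ {p n} {c : Code n} {xs y z} →
                    p ⊢ c [ xs ]↓ y → p ⊢ c [ xs ]↓ z → y ≡ z
  ↓-deterministic ↓zero         ↓zero           = refl
  ↓-deterministic ↓suc          ↓suc            = refl
  ↓-deterministic ↓proj         ↓proj           = refl
  ↓-deterministic ↓oracle       ↓oracle         = refl
  ↓-deterministic (↓comp ds c)  (↓comp ds′ c′)
    with refl ← ↓-deterministicᵥ ds ds′         = ↓-deterministic c c′
  ↓-deterministic (↓rec₀ c)     (↓rec₀ c′)      = ↓-deterministic c c′
  ↓-deterministic (↓rec₊ c d)   (↓rec₊ c′ d′)
    with refl ← ↓-deterministic c c′            = ↓-deterministic d d′
  ↓-deterministic (↓μ {y = y} below c) (↓μ {y = z} below′ c′) with <-cmp y z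
  ... | tri≈ _ y≡z _ = y≡z
  -- The smaller result is a zero of the function searched, while the derivation for the larger one
  -- has a successor there.
  ... | tri< y<z _ _ = contradiction (↓-deterministic c (proj₂ (below′ y y<z))) 0≢1+n
  ... | tri> _ _ z<y = contradiction (↓-deterministic (proj₂ (below z z<y)) c′) 1+n≢0

  ↓-deterministicᵥ : ∀ {p m n} {ds : Vec (Code n) m} {xs ys zs} →
                     Pointwise (λ d y → p ⊢ d [ xs ]↓ y) ds ys →
                     Pointwise (λ d z → p ⊢ d [ xs ]↓ z) ds zs → ys ≡ zs
  ↓-deterministicᵥ []       []         = refl
  ↓-deterministicᵥ (d ∷ ds) (d′ ∷ ds′) =
    cong₂ _∷_ (↓-deterministic d d′) (↓-deterministicᵥ ds ds′)

-- Continuity of evaluation in the oracle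

Agree : ℕ → Baire → Baire → Set
Agree M p r = ∀ i → i < M → r i ≡ p i

-- In topological terms, p lies in the interior of Φ in Baire space.
Near : Baire → (Baire → Set) → Set
Near p Φ = ∃[ M ] (∀ r → Agree M p r → Φ r)

near-map : ∀ {p Φ Ψ} → (∀ {r} → Φ r → Ψ r) → Near p Φ → Near p Ψ
near-map f (M , h) = M , λ r agree → f (h r agree)

near-zip : ∀ {p Φ Ψ Θ} → (∀ {r} → Φ r → Ψ r → Θ r) → Near p Φ → Near p Ψ → Near p Θ
near-zip f (M , h) (M′ , h′) = M ⊔ M′ , λ r agree →
  f (h  r (λ i i<M  → agree i (<-≤-trans i<M  (m≤m⊔n M M′))))
    (h′ r (λ i i<M′ → agree i (<-≤-trans i<M′ (m≤n⊔m M M′))))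

-- A finite intersection of neighbourhoods is a neighbourhood. This handles the failed search steps
-- of `μ`.
near-∀< : ∀ {p} {Φ : ℕ → Baire → Set} y → (∀ z → z < y → Near p (Φ z)) →
          Near p (λ r → ∀ z → z < y → Φ z r)
near-∀< zero    h = 0 , λ _ _ _ ()
near-∀< {Φ = Φ} (suc y) h =
  near-zip snoc (near-∀< y (λ z z<y → h z (m<n⇒m<1+n z<y))) (h y ≤-refl)
  where
  snoc : ∀ {r} → (∀ z → z < y → Φ z r) → Φ y r → ∀ z → z < suc y → Φ z r
  snoc below top z z<1+y with m≤n⇒m<n∨m≡n (s≤s⁻¹ z<1+y)
  ... | inj₁ z<y  = below z z<y
  ... | inj₂ refl = top

mutual

  -- A halting computation queries the oracle only finitely often; the modulus exceeds every queried
  -- position.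
  ↓-continuous : ∀ {p n} {c : Code n} {xs y} → p ⊢ c [ xs ]↓ y →
                 Near p (λ r → r ⊢ c [ xs ]↓ y)
  ↓-continuous ↓zero         = 0 , λ _ _ → ↓zero
  ↓-continuous ↓suc          = 0 , λ _ _ → ↓suc
  ↓-continuous ↓proj         = 0 , λ _ _ → ↓proj
  ↓-continuous (↓oracle {x}) = suc x , λ r agree →
    subst (r ⊢ oracle [ _ ]↓_) (agree x ≤-refl) ↓oracle
  ↓-continuous (↓comp ds c)  = near-zip ↓comp (↓-continuousᵥ ds) (↓-continuous c)
  ↓-continuous (↓rec₀ c)     = near-map ↓rec₀ (↓-continuous c)
  ↓-continuous (↓rec₊ c d)   = near-zip ↓rec₊ (↓-continuous c) (↓-continuous d)
  ↓-continuous (↓μ {y = y} below c) = near-zip ↓μ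
    (near-∀< y (λ z z<y →
      near-map (proj₁ (below z z<y) ,_) (↓-continuous (proj₂ (below z z<y)))))
    (↓-continuous c)

  ↓-continuousᵥ : ∀ {p m n} {ds : Vec (Code n) m} {xs ys} →
                  Pointwise (λ d y → p ⊢ d [ xs ]↓ y) ds ys →
                  Near p (λ r → Pointwise (λ d y → r ⊢ d [ xs ]↓ y) ds ys)
  ↓-continuousᵥ []       = 0 , λ _ _ → []
  ↓-continuousᵥ (d ∷ ds) = near-zip _∷_ (↓-continuous d) (↓-continuousᵥ ds)

-- Enumeration of codes

-- The height also bounds the arities of the outer functions in compositions;
-- otherwise there would be infinitely many codes of a given height.

mutual

  height : ∀ {n} → Code n → ℕ
  height zero            = 1
  height suc             = 1
  height (proj _)        = 1
  height oracle          = 1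
  height (comp {m} c ds) = suc (m ⊔ (height c ⊔ heightᵥ ds))
  height (rec c d)       = suc (height c ⊔ height d)
  height (μ c)           = suc (height c)

  heightᵥ : ∀ {m n} → Vec (Code n) m → ℕ
  heightᵥ []       = 0
  heightᵥ (d ∷ ds) = height d ⊔ heightᵥ ds

vectors : ∀ {X : Set} m → List X → List (Vec X m)
vectors zero    xs = [] ∷ []
vectors (suc m) xs = cartesianProductWith _∷_ xs (vectors m xs)

initialCodes : ∀ n → List (Code n)
initialCodes 0             = zero ∷ []
initialCodes 1             = suc ∷ oracle ∷ []
initialCodes (suc (suc _)) = []

mutual

  codes : ℕ → ∀ n → List (Code n)
  codes zero    n = []
  codes (suc d) n =
    initialCodes n ++
    map proj (allFin n) ++
    concatMap (compositions d n) (upTo (suc d)) ++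
    recursions d n ++
    map μ (codes d (suc n))

  compositions : ℕ → ∀ n m → List (Code n)
  compositions d n m = cartesianProductWith comp (codes d m) (vectors m (codes d n))

  recursions : ℕ → ∀ n → List (Code n)
  recursions d zero    = []
  recursions d (suc n) = cartesianProductWith rec (codes d n) (codes d (2 + n))

mutual

  -- Allows the maximum over one finite list to bound a quantity for all codes of height at most d.
  ∈-codes : ∀ {n} (c : Code n) {d} → height c ≤ d → c ∈ codes d n
  ∈-codes zero     (s≤s _) = here refl
  ∈-codes suc      (s≤s _) = here refl
  ∈-codes oracle   (s≤s _) = there (here refl)
  ∈-codes {n} (proj i) (s≤s _) =
    ∈-++⁺ʳ (initialCodes n) (∈-++⁺ˡ (∈-map⁺ proj (∈-allFin i)))
  ∈-codes {n} (comp {m} c ds) {suc k} (s≤s h) =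
    ∈-++⁺ʳ (initialCodes n) (∈-++⁺ʳ (map proj (allFin n)) (∈-++⁺ˡ
      (∈-concatMap⁺ (compositions k n) (lose (∈-upTo⁺ (s≤s (m⊔n≤o⇒m≤o m _ h)))
        (∈-cartesianProductWith⁺ comp
          (∈-codes c (m⊔n≤o⇒m≤o (height c) _ h′))
          (∈-vectors ds (m⊔n≤o⇒n≤o (height c) _ h′)))))))
    where h′ = m⊔n≤o⇒n≤o m _ h
  ∈-codes {suc n} (rec c d) {suc k} (s≤s h) =
    ∈-++⁺ʳ (initialCodes (suc n)) (∈-++⁺ʳ (map proj (allFin (suc n)))
      (∈-++⁺ʳ (concatMap (compositions k (suc n)) (upTo (suc k))) (∈-++⁺ˡ
        (∈-cartesianProductWith⁺ rec
          (∈-codes c (m⊔n≤o⇒m≤o (height c) _ h))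
          (∈-codes d (m⊔n≤o⇒n≤o (height c) _ h))))))
  ∈-codes {n} (μ c) {suc k} (s≤s h) =
    ∈-++⁺ʳ (initialCodes n) (∈-++⁺ʳ (map proj (allFin n))
      (∈-++⁺ʳ (concatMap (compositions k n) (upTo (suc k))) (∈-++⁺ʳ (recursions k n)
        (∈-map⁺ μ (∈-codes c h)))))

  ∈-vectors : ∀ {m n} (ds : Vec (Code n) m) {k} → heightᵥ ds ≤ k →
              ds ∈ vectors m (codes k n)
  ∈-vectors []       _ = here refl
  ∈-vectors (d ∷ ds) h =
    ∈-cartesianProductWith⁺ _∷_
      (∈-codes d (m⊔n≤o⇒m≤o (height d) _ h))
      (∈-vectors ds (m⊔n≤o⇒n≤o (height d) _ h))

-- Erasure

ErasedAt : Baire → Baire → ℕ → Set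
ErasedAt q p i = p i ≡ q i ⊎ (q i ≡ 1 × p i ≡ 0)

-- Disagreement is decidable and confined to positions below M, so filtering those positions yields
-- the list of erasures.
erasesFinitely : ∀ {q p} M → (∀ i → ErasedAt q p i) → (∀ i → M ≤ i → p i ≡ q i) →
                 ErasesFinitely q p
erasesFinitely {q} {p} M erased eventually = filter differ? (upTo M) , λ n → changed n , unchanged n
  where
  differ? : Decidable (λ i → p i ≢ q i)
  differ? i = ¬? (p i ≟ q i)

  changed : ∀ n → n ∈ filter differ? (upTo M) → q n ≡ 1 × p n ≡ 0
  changed n n∈ with erased n
  ... | inj₁ p≡q = contradiction p≡q (proj₂ (∈-filter⁻ differ? {xs = upTo M} n∈))
  ... | inj₂ e   = e

  unchanged : ∀ n → ¬ (n ∈ filter differ? (upTo M)) → p n ≡ q n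
  unchanged n n∉ = decidable-stable (p n ≟ q n) λ p≢q →
    n∉ (∈-filter⁺ differ? (∈-upTo⁺ (≰⇒> (p≢q ∘ eventually n))) p≢q)

erasedAt : ∀ {q p} → ErasesFinitely q p → ∀ i → ErasedAt q p i
erasedAt (ns , h) i with mem? _≟_ i ns
... | yes i∈ = inj₂ (proj₁ (h i) i∈)
... | no  i∉ = inj₁ (proj₂ (h i) i∉)

eventually≡ : ∀ {q p} → ErasesFinitely q p → ∃[ M ] (∀ i → M ≤ i → p i ≡ q i)
eventually≡ (ns , h) = suc (max 0 ns) , λ i big →
  proj₂ (h i) (λ i∈ → <⇒≱ big (lookup (xs≤max 0 ns) i∈))

splice : ℕ → Baire → Baire → Baire
splice M p q i = if does (i <? M) then p i else q i

splice-< : ∀ {M} p q {i} → i < M → splice M p q i ≡ p i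
splice-< {M} p q {i} i<M rewrite dec-true (i <? M) i<M = refl

splice-≥ : ∀ {M} p q {i} → M ≤ i → splice M p q i ≡ q i
splice-≥ {M} p q {i} M≤i rewrite dec-false (i <? M) (≤⇒≯ M≤i) = refl

-- In the applications ι is n ↦ 2n or n ↦ 2n + 1.

splice-erases : ∀ {q} M u v (ι : ℕ → ℕ) → (∀ i → i ≤ ι i) →
                (∀ i → ι i < M → ErasedAt q (u ∘ ι) i) → ErasesFinitely q (v ∘ ι) →
                ErasesFinitely q (splice M u v ∘ ι)
splice-erases {q} M u v ι i≤ι u-erased v-erases with eventually≡ v-erases
... | K , v≡q = erasesFinitely (M ⊔ K) erased eventually
  where
  erased : ∀ i → ErasedAt q (splice M u v ∘ ι) i
  erased i with <-≤-connex (ι i) M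
  ... | inj₁ ι<M rewrite splice-< u v ι<M = u-erased i ι<M
  ... | inj₂ M≤ι rewrite splice-≥ u v M≤ι = erasedAt v-erases i

  eventually : ∀ i → M ⊔ K ≤ i → splice M u v (ι i) ≡ q i
  eventually i big = trans
    (splice-≥ u v (≤-trans (m⊔n≤o⇒m≤o M K big) (i≤ι i)))
    (v≡q i (m⊔n≤o⇒n≤o M K big))

module _ {A : Pred ℕ 0ℓ} (A? : Decidable A) where

  χ-true : ∀ {i} → A i → χ A? i ≡ 1
  χ-true {i} Ai rewrite dec-true (A? i) Ai = refl

  χ-binary : ∀ i → χ A? i ≡ 0 ⊎ χ A? i ≡ 1
  χ-binary i with A? i
  ... | yes _ = inj₂ refl
  ... | no  _ = inj₁ refl

  χ-erasable : ∀ {p i} → p i ≡ 0 → ErasedAt (χ A?) p i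
  χ-erasable {i = i} p≡0 with χ-binary i
  ... | inj₁ χ≡0 = inj₁ (trans p≡0 (sym χ≡0))
  ... | inj₂ χ≡1 = inj₂ (χ≡1 , p≡0)

-- Diagonalisation

BinaryFrom : ℕ → Baire → Set
BinaryFrom N p = ∀ i → p i ≡ 0 ⊎ (N ≤ i × p i ≡ 1)

-- Stated for an arbitrary set, so that it serves the name of `a` and, with the complement, the name
-- of `b`.
splice-binaryFrom : ∀ {A : Pred ℕ 0ℓ} (A? : Decidable A) N v (ι : ℕ → ℕ) →
                    (∀ i → 2 * N ≤ ι i → N ≤ i) → ErasesFinitely (χ A?) (v ∘ ι) →
                    BinaryFrom N (splice (2 * N) (λ _ → 0) v ∘ ι)
splice-binaryFrom A? N v ι 2N≤ι⇒N≤i v-erases i with <-≤-connex (ι i) (2 * N)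
... | inj₁ ι<2N = inj₁ (splice-< (λ _ → 0) v ι<2N)
... | inj₂ 2N≤ι rewrite splice-≥ (λ _ → 0) v 2N≤ι with erasedAt v-erases i | χ-binary A? i
...   | inj₂ (_ , v≡0) | _        = inj₁ v≡0
...   | inj₁ v≡χ       | inj₁ χ≡0 = inj₁ (trans v≡χ χ≡0)
...   | inj₁ v≡χ       | inj₂ χ≡1 = inj₂ (2N≤ι⇒N≤i i 2N≤ι , trans v≡χ χ≡1)

-- No set A occurs here, because A is later built from the bounds M. That only entries below M are
-- read is expressed by stability under changing the others.
record Fires (e : Code 1) (N M : ℕ) : Set where
  constructor fires
  field
    pair    : Baire
    left    : BinaryFrom N (evens pair)
    right   : BinaryFrom N (odds pair)
    input   : ℕ
    output  : ℕ
    outputs : ∀ r → Agree M pair r → r ⊢ e [ input ∷ [] ]↓ suc output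

Distinguishes : RepresentedSpace → Code 1 → Set
Distinguishes X e = ∀ x y p → Names (X ⊗ X) p (x , y) →
  ∃[ q ] (e ∶ p ↦ q × (x ≡ y → ∀ n → q n ≡ 0) × (x ≢ y → ¬ (∀ n → q n ≡ 0)))

-- The characteristic map is eliminated: a point of `𝕊` other than `⊤` is `⊥`, so its names are zero
-- everywhere.
hausdorff⇒distinguishes : ∀ X → ComputablyHausdorff X → ∃[ e ] Distinguishes X e
hausdorff⇒distinguishes X (f , f⇔ , e , f-computable) = e , λ x y p px →
  let (q , e↦q , q-names) = f-computable (x , y) p px in
  q , e↦q ,
  (λ x≡y → names-⊥ (f (x , y)) q-names λ f≡⊤ → Equivalence.to (f⇔ (x , y)) f≡⊤ x≡y) ,
  (λ x≢y → subst (NamesSierpiński q) (Equivalence.from (f⇔ (x , y)) x≢y) q-names)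
  where
  names-⊥ : ∀ {q} s → NamesSierpiński q s → s ≢ ⊤ → ∀ n → q n ≡ 0
  names-⊥ ⊤ _   s≢⊤ = contradiction refl s≢⊤
  names-⊥ ⊥ q≡0 _   = q≡0

module _ {A : Pred ℕ 0ℓ} (A? : Decidable A) (inf : Inf A) (coinf : Inf (∁ A))
         {e : Code 1} (e-distinguishes : Distinguishes (D A A? inf coinf) e) (N : ℕ) where

  private
    X = D A A? inf coinf

    n≤2n : ∀ n → n ≤ 2 * n
    n≤2n n = m≤m+n n (n + 0)

    n≤1+2n : ∀ n → n ≤ 1 + 2 * n
    n≤1+2n n = m≤n⇒m≤1+n (n≤2n n)

  -- A name of `⊤` is only known not to vanish everywhere, hence the double negation. Continuity
  -- turns a nonzero output into an instance of `Fires`.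
  distinguishes⇒¬¬fires : ¬ ¬ (∃[ M ] Fires e N M)
  distinguishes⇒¬¬fires never =
    let (v , v-left , v-right) = surjective (X ⊗ X) (a , b)
        -- The first 2N entries of a pair are exactly the first N entries of each component.
        s = splice (2 * N) (λ _ → 0) v
        (q , e↦q , _ , q≢0) = e-distinguishes a b s
          ( splice-erases (2 * N) (λ _ → 0) v (2 *_) n≤2n (λ _ _ → χ-erasable A? refl) v-left
          , splice-erases (2 * N) (λ _ → 0) v (λ i → 1 + 2 * i) n≤1+2n
              (λ _ _ → χ-erasable (∁? A?) refl) v-right )
        left  = splice-binaryFrom A? N v (2 *_) (λ _ → *-cancelˡ-≤ 2) v-left
        right = splice-binaryFrom (∁? A?) N v (λ i → 1 + 2 * i) 2N≤1+2i⇒N≤i v-right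
    in q≢0 (λ ()) (all-zero left right e↦q)
    where
    2N≤1+2i⇒N≤i : ∀ i → 2 * N ≤ 1 + 2 * i → N ≤ i
    2N≤1+2i⇒N≤i i h = s≤s⁻¹ (*-cancelˡ-< 2 N (suc i)
      (subst (2 * N <_) (sym (*-suc 2 i)) (s≤s h)))

    all-zero : ∀ {s q} → BinaryFrom N (evens s) → BinaryFrom N (odds s) →
               e ∶ s ↦ q → ∀ n → q n ≡ 0
    all-zero {s} {q} left right e↦q n with q n | e↦q n
    ... | zero  | _  = refl
    ... | suc k | ↓k =
      let (M , outputs) = ↓-continuous ↓k
      in contradiction (M , fires s left right n k outputs) never

  distinguishes⇒¬fires : ∀ {M} → (∀ i → N ≤ i → i < M → A i) → ¬ Fires e N M
  distinguishes⇒¬fires {M} A-full (fires s left right n k outputs) =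
    let (v , v-left , v-right) = surjective (X ⊗ X) (a , a)
        r = splice M s v
        (q , e↦q , q≡0 , _) = e-distinguishes a a r
          ( splice-erases M s v (2 *_) n≤2n (erased (2 *_) n≤2n left) v-left
          , splice-erases M s v (λ i → 1 + 2 * i) n≤1+2n (erased (λ i → 1 + 2 * i) n≤1+2n right) v-right )
    -- On input n the same oracle gives `suc k`, by agreement with s below M, and 0, since both
    -- components name `a`.
    in contradiction
         (trans (↓-deterministic (outputs r (λ _ → splice-< s v)) (e↦q n)) (q≡0 refl n))
         1+n≢0
    where
    erased : ∀ (ι : ℕ → ℕ) → (∀ i → i ≤ ι i) → BinaryFrom N (s ∘ ι) →
             ∀ i → ι i < M → ErasedAt (χ A?) (s ∘ ι) i
    erased ι i≤ι binary i ι<M with binary i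
    ... | inj₁ s≡0         = χ-erasable A? {s ∘ ι} s≡0
    ... | inj₂ (N≤i , s≡1) =
      -- A component index is at most its index in the pair, so i lies between N and M, where A is
      -- full.
      inj₁ (trans s≡1 (sym (χ-true A? (A-full i N≤i (≤-<-trans (i≤ι i) ι<M)))))

-- The fast-growing function and the set avoiding its range

module Construction (em : ExcludedMiddle 0ℓ) where

  -- The decision is an argument so that a case split on `em` also reduces `use`. The default 0
  -- leaves the maximum in `gap` unchanged.
  useBound : ∀ {e N} → Dec (∃[ M ] Fires e N M) → ℕ
  useBound (yes (M , _)) = M
  useBound (no _)        = 0

  use : ℕ → Code 1 → ℕ
  use N e = useBound {e} {N} em

  use-fires : ∀ {e N} → ¬ ¬ (∃[ M ] Fires e N M) → Fires e N (use N e)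
  use-fires {e} {N} ¬¬f with em {∃[ M ] Fires e N M}
  ... | yes (_ , f) = f
  ... | no ¬f       = contradiction ¬f ¬¬f

  -- This is the function g of the overview.
  gap : ℕ → ℕ
  gap zero    = 0
  -- The summand 2 keeps `suc (gap d)` strictly between consecutive values, which makes A infinite.
  gap (suc d) = 2 + (gap d ⊔ max 0 (map (use (suc (gap d))) (codes d 1)))

  gap-step : ∀ d → 2 + gap d ≤ gap (suc d)
  gap-step d = s≤s (s≤s (m≤m⊔n (gap d) _))

  gap-mono : ∀ {c d} → c ≤′ d → gap c ≤ gap d
  gap-mono ≤′-refl           = ≤-refl
  gap-mono (≤′-step {d} c≤d) =
    ≤-trans (gap-mono c≤d) (≤-trans (m≤n+m (gap d) 2) (gap-step d))

  n≤gap : ∀ n → n ≤ gap n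
  n≤gap zero    = ≤-refl
  n≤gap (suc n) = ≤-trans (s≤s (m≤n⇒m≤1+n (n≤gap n))) (gap-step n)

  use≤gap : ∀ {e d} → height e ≤ d → use (suc (gap d)) e ≤ gap (suc d)
  use≤gap {e} {d} h = begin
    use N e                      ≤⟨ lookup (xs≤max 0 uses) (∈-map⁺ (use N) (∈-codes e h)) ⟩
    max 0 uses                   ≤⟨ m≤n⊔m (gap d) _ ⟩
    gap d ⊔ max 0 uses           ≤⟨ m≤n+m _ 2 ⟩
    gap (suc d)                  ∎
    where
    open ≤-Reasoning
    N    = suc (gap d)
    uses = map (use N) (codes d 1)

  A : Pred ℕ 0ℓ
  A i = ∀ d → i ≢ gap d

  between-gaps : ∀ {d i} → gap d < i → i < gap (suc d) → A i
  between-gaps {d} lo hi c refl with ≤-<-connex c d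
  ... | inj₁ c≤d = <⇒≱ lo (gap-mono (≤⇒≤′ c≤d))
  ... | inj₂ d<c = <⇒≱ hi (gap-mono (≤⇒≤′ d<c))

  A-infinite : Inf A
  A-infinite (i , none) =
    none (suc (gap i)) (m≤n⇒m≤1+n (n≤gap i)) (between-gaps {i} ≤-refl (gap-step i))

  A-coinfinite : Inf (∁ A)
  A-coinfinite (i , none) = none (gap i) (n≤gap i) (λ Ai → Ai i refl)

  not-hausdorff : ¬ ComputablyHausdorff (D A (λ _ → em) A-infinite A-coinfinite)
  not-hausdorff hausdorff with hausdorff⇒distinguishes (D A (λ _ → em) A-infinite A-coinfinite) hausdorff
  ... | e , e-distinguishes =
    distinguishes⇒¬fires (λ _ → em) A-infinite A-coinfinite e-distinguishes N
      -- At stage `height e` the code e itself is among those bounded, so its use ends no later than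
      -- the next value of `gap`.
      (λ i N≤i i<use → between-gaps {height e} N≤i (<-≤-trans i<use (use≤gap {e} ≤-refl)))
      (use-fires (distinguishes⇒¬¬fires (λ _ → em) A-infinite A-coinfinite e-distinguishes N))
    where N = suc (gap (height e))

proposition30 : (em : ExcludedMiddle 0ℓ) → Σ[ A ∈ Pred ℕ 0ℓ ] Σ[ inf ∈ Inf A ] Σ[ coinf ∈ Inf (∁ A) ] ¬ ComputablyHausdorff (D A (λ _ → em) inf coinf)
proposition30 em = A , A-infinite , A-coinfinite , not-hausdorff
  where open Construction em
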